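{- (Total-correctness completeness.) For any statement $s$, state predicate $U$ and setoid trace predicate $P$, if for every state $\sigma$ with $\sigma\models U$ there is a trace $\tau$ with $s,\sigma\Rightarrow\tau$ and $\tau\models P$, then $\vdash\{U\}\,s\,\{P\}$ is derivable in the trace-based Hoare logic.
   Context: While statements: $s ::= x:=e \mid \mathsf{skip}\mid s_0;s_1\mid \mathsf{if}\ e\ \mathsf{then}\ s_t\ \mathsf{else}\ s_f\mid \mathsf{while}\ e\ \mathsf{do}\ s_t$, with $x$ integer variables and $e$ arithmetic expressions; a state $\sigma$ assigns integers to variables, $[\![e]\!]\sigma$ is the value, $\sigma\models e$ means $e$ is true in $\sigma$. The metatheory is constructive; assertions are arbitrary predicates expressible in the metalogic. Traces are coinductive: $\langle\sigma\rangle$, and $\sigma::\tau$ for a trace $\tau$; bisimilarity $\approx$ is coinductive ($\langle\sigma\rangle\approx\langle\sigma\rangle$; $\sigma::\tau\approx\sigma::\tau'$ if $\tau\approx\tau'$); $\mathit{hd}\langle\sigma\rangle=\mathit{hd}(\sigma::\tau)=\sigma$. Evaluation $s,\sigma\Rightarrow\tau$ and extended evaluation $s,\tau\Rightarrow^*\tau'$ are defined simultaneously coinductively by: $x:=e,\sigma\Rightarrow\sigma::\langle\sigma[x\mapsto[\![e]\!]\sigma]\rangle$; $\mathsf{skip},\sigma\Rightarrow\langle\sigma\rangle$; $s_0;s_1,\sigma\Rightarrow\tau'$ if $s_0,\sigma\Rightarrow\tau$ and $s_1,\tau\Rightarrow^*\tau'$; $\mathsf{if}\ e\ \mathsf{then}\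 s_t\ \mathsf{else}\ s_f,\sigma\Rightarrow\tau$ if $\sigma\models e$ and $s_t,\sigma::\langle\sigma\rangle\Rightarrow^*\tau$, or if $\sigma\not\models e$ and $s_f,\sigma::\langle\sigma\rangle\Rightarrow^*\tau$; $\mathsf{while}\ e\ \mathsf{do}\ s_t,\sigma\Rightarrow\tau'$ if $\sigma\models e$, $s_t,\sigma::\langle\sigma\rangle\Rightarrow^*\tau$ and $\mathsf{while}\ e\ \mathsf{do}\ s_t,\tau\Rightarrow^*\tau'$; $\mathsf{while}\ e\ \mathsf{do}\ s_t,\sigma\Rightarrow\sigma::\langle\sigma\rangle$ if $\sigma\not\models e$; $s,\langle\sigma\rangle\Rightarrow^*\tau$ if $s,\sigma\Rightarrow\tau$; $s,\sigma::\tau\Rightarrow^*\sigma::\tau'$ if $s,\tau\Rightarrow^*\tau'$. State predicates are arbitrary; trace predicates are setoid predicates (invariant under $\approx$); $\wedge,\neg,\exists$ are pointwise; $\models$ is also entailment. $\langle U\rangle$ holds exactly of $\langle\sigma\rangle$ with $\sigma\models U$; $\mathrm{dup}(U)$ exactly of $\sigma::\langle\sigma\rangle$ with $\sigma\models U$; $U[x\mapsto e]$ exactly of $\sigma::\langle\sigma[x\mapsto[\![e]\!]\sigma]\rangle$ with $\sigma\models U$. $\mathrm{follows}_Q(\tau,\tau')$ is coinductive: $\mathrm{follows}_Q(\langle\sigma\rangle,\tau)$ if $\mathit{hd}\,\tau=\sigma$ and $\tau\models Q$; $\mathrm{follows}_Q(\sigma::\tau,\sigma::\tau')$ if $\mathrm{follows}_Q(\tau,\tau')$.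 $\tau'\models P\ast\ast Q$ iff $\exists\tau$, $\tau\models P$ and $\mathrm{follows}_Q(\tau,\tau')$ (chains associate to the right). $P^{\dagger}$ is coinductive: $\tau\models P^{\dagger}$ if $\tau\models\langle\mathsf{true}\rangle$; $\tau'\models P^{\dagger}$ if $\exists\tau$, $\tau\models P$ and $\mathrm{follows}_{P^{\dagger}}(\tau,\tau')$. The trace-based Hoare logic derives $\{U\}\,s\,\{P\}$ inductively by: $\{U\}\,x:=e\,\{U[x\mapsto e]\}$; $\{U\}\,\mathsf{skip}\,\{\langle U\rangle\}$; from $\{U\}\,s_0\,\{P\ast\ast\langle V\rangle\}$ and $\{V\}\,s_1\,\{Q\}$ infer $\{U\}\,s_0;s_1\,\{P\ast\ast Q\}$; from $\{e\wedge U\}\,s_t\,\{P\}$ and $\{\neg e\wedge U\}\,s_f\,\{P\}$ infer $\{U\}\,\mathsf{if}\ e\ \mathsf{then}\ s_t\ \mathsf{else}\ s_f\,\{\mathrm{dup}(U)\ast\ast P\}$; from $U\models I$ and $\{e\wedge I\}\,s_t\,\{P\ast\ast\langle I\rangle\}$ infer $\{U\}\,\mathsf{while}\ e\ \mathsf{do}\ s_t\,\{\mathrm{dup}(U)\ast\ast(P\ast\ast\mathrm{dup}(I))^{\dagger}\ast\ast\langle\neg e\rangle\}$; from $U\models U'$, $\{U'\}\,s\,\{P'\}$, $P'\models P$ infer $\{U\}\,s\,\{P\}$; from $\forall z.\ \{U_z\}\,s\,\{P_z\}$ infer $\{\exists z.U_z\}\,s\,\{\exists z.P_z\}$. -}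

module Defs where

-- Agda is run here without --guardedness / --sized-types, so coinductive
-- types and predicates are encoded:
--  * traces are observed through functions ℕ → State and ℕ → Bool
--    (position n carries a state; 'fin t n ≡ true' means the trace ends there);
--  * every coinductive relation is the greatest fixed point of its rule
--    functor, encoded à la Knaster–Tarski as "membership in some post-fixed
--    point" (GFP below); constructor patterns ⟨σ⟩ and σ ∷ τ in rule
--    conclusions are matched observationally via IsEnd / IsCons / hd / tl.

open import Level using (Level; 0ℓ; _⊔_; Lift) renaming (suc to lsuc)
open import Data.Bool using (Bool; true; false)
open import Data.Nat as ℕ using (ℕ; zero; suc)
open import Data.Integer as ℤ using (ℤ)
open import Data.Product using (Σ; _×_; _,_; proj₁; proj₂)
open import Data.Sum using (_⊎_; inj₁; inj₂)
open import Data.Empty using (⊥; ⊥-elim)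
open import Relation.Nullary using (¬_; yes; no)
open import Relation.Binary.PropositionalEquality
  using (_≡_; refl; sym; trans; subst; cong)

Var : Set
Var = ℕ

data Expr : Set where
  lit  : ℤ → Expr
  var  : Var → Expr
  _⊕_  : Expr → Expr → Expr
  _⊖_  : Expr → Expr → Expr
  _⊗_  : Expr → Expr → Expr

-- While statements ('do' is an Agda keyword, hence DO).
data Stmt : Set where
  _≔_           : Var → Expr → Stmt
  skip          : Stmt
  _⨾_           : Stmt → Stmt → Stmt
  if_then_else_ : Expr → Stmt → Stmt → Stmt
  while_DO_     : Expr → Stmt → Stmt

State : Set
State = Var → ℤ

⟦_⟧ : Expr → State → ℤ
⟦ lit n ⟧ σ = n
⟦ var x ⟧ σ = σ x
⟦ e ⊕ f ⟧ σ = ⟦ e ⟧ σ ℤ.+ ⟦ f ⟧ σ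
⟦ e ⊖ f ⟧ σ = ⟦ e ⟧ σ ℤ.- ⟦ f ⟧ σ
⟦ e ⊗ f ⟧ σ = ⟦ e ⟧ σ ℤ.* ⟦ f ⟧ σ

-- σ ⊨ e : the expression e is true in σ (C convention: nonzero value).
_⊨_ : State → Expr → Set
σ ⊨ e = ¬ (⟦ e ⟧ σ ≡ ℤ.0ℤ)

_[_↦_] : State → Var → ℤ → State
(σ [ x ↦ v ]) y with x ℕ.≟ y
... | yes _ = v
... | no  _ = σ y

GFP : {I : Set} {ℓ : Level} → ((I → Set) → I → Set ℓ) → I → Set (lsuc 0ℓ ⊔ ℓ)
GFP {I} F i = Σ (I → Set) λ R → R i × (∀ j → R j → F R j)

record Trace : Set where
  constructor mkTrace
  field
    st  : ℕ → State
    fin : ℕ → Bool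
open Trace public

private
  consF : {A : Set} → A → (ℕ → A) → ℕ → A
  consF a f zero    = a
  consF a f (suc n) = f n

⟨_⟩ : State → Trace
⟨ σ ⟩ = mkTrace (λ _ → σ) (λ _ → true)

infixr 5 _∷_
_∷_ : State → Trace → Trace
σ ∷ τ = mkTrace (consF σ (st τ)) (consF false (fin τ))

hd : Trace → State
hd τ = st τ 0

tl : Trace → Trace
tl τ = mkTrace (λ n → st τ (suc n)) (λ n → fin τ (suc n))

-- observational view: τ is ⟨ hd τ ⟩, or τ is hd τ :: tl τ
IsEnd : Trace → Set
IsEnd τ = fin τ 0 ≡ true

IsCons : Trace → Set
IsCons τ = fin τ 0 ≡ false

-- Bisimilarity (coinductive):
--   ⟨σ⟩ ≈ ⟨σ⟩ ;   σ :: τ ≈ σ :: τ'  if  τ ≈ τ'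

BisimF : (Trace × Trace → Set) → Trace × Trace → Set
BisimF R (τ , τ') =
  (IsEnd τ × IsEnd τ' × hd τ ≡ hd τ')
  ⊎ (IsCons τ × IsCons τ' × hd τ ≡ hd τ' × R (tl τ , tl τ'))

infix 4 _≈_
_≈_ : Trace → Trace → Set₁
τ ≈ τ' = GFP BisimF (τ , τ')

-- Big-step coinductive trace semantics, defined simultaneously:
--   Exec s σ τ    is   s, σ ⇒ τ
--   Execs s τ τ'  is   s, τ ⇒* τ'

data EIdx : Set where
  ex  : Stmt → State → Trace → EIdx
  exs : Stmt → Trace → Trace → EIdx

ExecF : (EIdx → Set) → EIdx → Set
-- x:=e, σ ⇒ σ :: ⟨σ[x ↦ ⟦e⟧σ]⟩
ExecF R (ex (x ≔ e) σ τ) =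
  IsCons τ × hd τ ≡ σ × IsEnd (tl τ) × hd (tl τ) ≡ σ [ x ↦ ⟦ e ⟧ σ ]
-- skip, σ ⇒ ⟨σ⟩
ExecF R (ex skip σ τ) = IsEnd τ × hd τ ≡ σ
-- s₀;s₁, σ ⇒ τ'  if  s₀, σ ⇒ τ  and  s₁, τ ⇒* τ'
ExecF R (ex (s₀ ⨾ s₁) σ τ') =
  Σ Trace λ τ → R (ex s₀ σ τ) × R (exs s₁ τ τ')
ExecF R (ex (if e then sₜ else s_f) σ τ) =
  (σ ⊨ e × R (exs sₜ (σ ∷ ⟨ σ ⟩) τ))
  ⊎ (¬ (σ ⊨ e) × R (exs s_f (σ ∷ ⟨ σ ⟩) τ))
ExecF R (ex (while e DO sₜ) σ τ') =
  (σ ⊨ e × Σ Trace λ τ → R (exs sₜ (σ ∷ ⟨ σ ⟩) τ) × R (exs (while e DO sₜ) τ τ'))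
  ⊎ (¬ (σ ⊨ e) × (IsCons τ' × hd τ' ≡ σ × IsEnd (tl τ') × hd (tl τ') ≡ σ))
-- s, ⟨σ⟩ ⇒* τ  if  s, σ ⇒ τ ;   s, σ :: τ ⇒* σ :: τ'  if  s, τ ⇒* τ'
ExecF R (exs s τ τ') =
  (IsEnd τ × R (ex s (hd τ) τ'))
  ⊎ (IsCons τ × IsCons τ' × hd τ' ≡ hd τ × R (exs s (tl τ) (tl τ')))

Exec : Stmt → State → Trace → Set₁
Exec s σ τ = GFP ExecF (ex s σ τ)

Execs : Stmt → Trace → Trace → Set₁
Execs s τ τ' = GFP ExecF (exs s τ τ')

StPred : Set₂
StPred = State → Set₁

_⊨ˢ_ : StPred → StPred → Set₁
U ⊨ˢ V = ∀ σ → U σ → V σ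

_∧ᵉ_ : Expr → StPred → StPred
(e ∧ᵉ U) σ = σ ⊨ e × U σ

_¬∧ᵉ_ : Expr → StPred → StPred
(e ¬∧ᵉ U) σ = ¬ (σ ⊨ e) × U σ

¬ᵉ_ : Expr → StPred
(¬ᵉ e) σ = Lift (lsuc 0ℓ) (¬ (σ ⊨ e))

∃ˢ : {Z : Set₁} → (Z → StPred) → StPred
∃ˢ {Z} U σ = Σ Z λ z → U z σ

record TPred : Set₂ where
  field
    pred : Trace → Set₁
    resp : ∀ {τ τ'} → τ ≈ τ' → pred τ → pred τ'
open TPred public

_⊨ᵗ_ : TPred → TPred → Set₁
P ⊨ᵗ Q = ∀ τ → pred P τ → pred Q τ

-- follows_Q (coinductive):
--   follows_Q(⟨σ⟩, τ)  if  hd τ = σ and τ ⊨ Q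
--   follows_Q(σ :: τ, σ :: τ')  if  follows_Q(τ, τ')

FollowsF : {q : Level} → (Trace → Set q) →
  (Trace × Trace → Set) → Trace × Trace → Set q
FollowsF Q R (τ , τ') =
  (IsEnd τ × hd τ' ≡ hd τ × Q τ')
  ⊎ (IsCons τ × IsCons τ' × hd τ' ≡ hd τ × R (tl τ , tl τ'))

Follows : {q : Level} → (Trace → Set q) → Trace → Trace → Set (lsuc 0ℓ ⊔ q)
Follows Q τ τ' = GFP (FollowsF Q) (τ , τ')

-- P† (coinductive):
--   τ ⊨ P†  if  τ ⊨ ⟨true⟩ ;   τ' ⊨ P†  if  τ ⊨ P and follows_{P†}(τ, τ')
DaggerF : (Trace → Set₁) → (Trace → Set) → Trace → Set₁
DaggerF P R τ' = IsEnd τ' ⊎ Σ Trace λ τ → P τ × Follows R τ τ'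

Dagger : (Trace → Set₁) → Trace → Set₁
Dagger P = GFP (DaggerF P)

private
  t≢f : true ≡ false → ⊥
  t≢f ()

  ≈-hd : ∀ {τ τ'} → τ ≈ τ' → hd τ ≡ hd τ'
  ≈-hd (S , s , post) with post _ s
  ... | inj₁ (_ , _ , h) = h
  ... | inj₂ (_ , _ , h , _) = h

  ≈-end : ∀ {τ τ'} → τ ≈ τ' → IsEnd τ → IsEnd τ'
  ≈-end (S , s , post) e with post _ s
  ... | inj₁ (_ , e' , _) = e'
  ... | inj₂ (c , _) = ⊥-elim (t≢f (trans (sym e) c))

  ≈-cons : ∀ {τ τ'} → τ ≈ τ' → IsCons τ → IsCons τ' × tl τ ≈ tl τ'
  ≈-cons (S , s , post) c with post _ s
  ... | inj₁ (e , _) = ⊥-elim (t≢f (trans (sym e) c))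
  ... | inj₂ (_ , c' , _ , s') = c' , (S , s' , post)

  follows-map : ∀ {q q'} {Q : Trace → Set q} {Q' : Trace → Set q'}
    (S : Trace × Trace → Set) → (∀ j → S j → BisimF S j) →
    (∀ c b → S (c , b) → Q c → Q' b) →
    ∀ {τ t t'} → Follows Q τ t → S (t , t') → Follows Q' τ t'
  follows-map {Q = Q} {Q'} S postS g {τ} {t} {t'} (R , r , postR) s =
    R' , (t , r , s) , post'
    where
    R' : Trace × Trace → Set
    R' (a , b) = Σ Trace λ c → R (a , c) × S (c , b)
    hdS : ∀ {c b} → S (c , b) → hd c ≡ hd b
    hdS {c} {b} sc with postS (c , b) sc
    ... | inj₁ (_ , _ , h) = h
    ... | inj₂ (_ , _ , h , _) = h
    post' : ∀ j → R' j → FollowsF Q' R' j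
    post' (a , b) (c , rac , scb) with postR (a , c) rac
    ... | inj₁ (ea , hc , qc) =
      inj₁ (ea , trans (sym (hdS scb)) hc , g c b scb qc)
    ... | inj₂ (ca , cc , hc , r') with postS (c , b) scb
    ...   | inj₁ (ec , _) = ⊥-elim (t≢f (trans (sym ec) cc))
    ...   | inj₂ (_ , cb , hcb , s') =
      inj₂ (ca , cb , trans (sym hcb) hc , (tl c , r' , s'))

  dagger-resp : ∀ {P : Trace → Set₁} → (∀ {τ τ'} → τ ≈ τ' → P τ → P τ') →
    ∀ {τ τ'} → τ ≈ τ' → Dagger P τ → Dagger P τ'
  dagger-resp {P} rP {τ} {τ'} (S , s , postS) (R , r , postR) =
    R' , (τ , r , s) , post'
    where
    R' : Trace → Set
    R' b = Σ Trace λ c → R c × S (c , b)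
    post' : ∀ j → R' j → DaggerF P R' j
    post' b (c , rc , scb) with postR c rc
    ... | inj₁ e = inj₁ (≈-end (S , scb , postS) e)
    ... | inj₂ (τ₀ , p , f) =
      inj₂ (τ₀ , p , follows-map S postS (λ c' b' s' rc' → c' , rc' , s') f scb)

⟨_⟩ᵗ : StPred → TPred
pred ⟨ U ⟩ᵗ τ = IsEnd τ × U (hd τ)
resp ⟨ U ⟩ᵗ eq (e , u) = ≈-end eq e , subst U (≈-hd eq) u

-- dup(U) : holds exactly of σ :: ⟨ σ ⟩ with σ ⊨ U
dup : StPred → TPred
pred (dup U) τ = IsCons τ × IsEnd (tl τ) × hd (tl τ) ≡ hd τ × U (hd τ)
resp (dup U) eq (c , e , h , u) =
  let (c' , eq') = ≈-cons eq c in
  c' , ≈-end eq' e , trans (sym (≈-hd eq')) (trans h (≈-hd eq)) ,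
  subst U (≈-hd eq) u

-- U[x ↦ e] : holds exactly of σ :: ⟨ σ[x ↦ ⟦e⟧σ] ⟩ with σ ⊨ U
_[_≔_]ᵗ : StPred → Var → Expr → TPred
pred (U [ x ≔ e ]ᵗ) τ =
  IsCons τ × IsEnd (tl τ) × hd (tl τ) ≡ hd τ [ x ↦ ⟦ e ⟧ (hd τ) ] × U (hd τ)
resp (U [ x ≔ e ]ᵗ) {τ} {τ'} eq (c , en , h , u) =
  let (c' , eq') = ≈-cons eq c in
  c' , ≈-end eq' en ,
  trans (sym (≈-hd eq')) (subst (λ σ → hd (tl τ) ≡ σ [ x ↦ ⟦ e ⟧ σ ]) (≈-hd eq) h) ,
  subst U (≈-hd eq) u

infixr 6 _**_
_**_ : TPred → TPred → TPred
pred (P ** Q) τ' = Σ Trace λ τ → pred P τ × Follows (pred Q) τ τ'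
resp (P ** Q) (S , s , postS) (τ , p , f) =
  τ , p , follows-map S postS (λ c b scb q → resp Q (S , scb , postS) q) f s

_† : TPred → TPred
pred (P †) = Dagger (pred P)
resp (P †) eq d = dagger-resp (resp P) eq d

∃ᵗ : {Z : Set₁} → (Z → TPred) → TPred
pred (∃ᵗ {Z} P) τ = Σ Z λ z → pred (P z) τ
resp (∃ᵗ P) eq (z , p) = z , resp (P z) eq p

data ⊢[_]_[_] : StPred → Stmt → TPred → Set₂ where
  h-assign : ∀ {U x e} → ⊢[ U ] (x ≔ e) [ U [ x ≔ e ]ᵗ ]
  h-skip   : ∀ {U} → ⊢[ U ] skip [ ⟨ U ⟩ᵗ ]
  h-seq    : ∀ {U V P Q s₀ s₁} →
    ⊢[ U ] s₀ [ P ** ⟨ V ⟩ᵗ ] → ⊢[ V ] s₁ [ Q ] →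
    ⊢[ U ] (s₀ ⨾ s₁) [ P ** Q ]
  h-if     : ∀ {U P e sₜ s_f} →
    ⊢[ e ∧ᵉ U ] sₜ [ P ] → ⊢[ e ¬∧ᵉ U ] s_f [ P ] →
    ⊢[ U ] (if e then sₜ else s_f) [ dup U ** P ]
  h-while  : ∀ {U I P e sₜ} →
    U ⊨ˢ I → ⊢[ e ∧ᵉ I ] sₜ [ P ** ⟨ I ⟩ᵗ ] →
    ⊢[ U ] (while e DO sₜ) [ dup U ** ((P ** dup I) †) ** ⟨ ¬ᵉ e ⟩ᵗ ]
  h-conseq : ∀ {U U' P P' s} →
    U ⊨ˢ U' → ⊢[ U' ] s [ P' ] → P' ⊨ᵗ P → ⊢[ U ] s [ P ]
  h-exists : ∀ {Z : Set₁} {U : Z → StPred} {P : Z → TPred} {s} →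
    (∀ z → ⊢[ U z ] s [ P z ]) → ⊢[ ∃ˢ U ] s [ ∃ᵗ P ]

module Submission where

-- Following the paper, the proof goes through STRONGEST POSTCONDITIONS:
-- Sp U s holds of τ when τ is an execution of s from some state satisfying
-- U.  By induction on s we derive ⊢ {U} s {Sp U s} for every U (complete),
-- choosing the intermediate assertion for ⨾ as the set of final states of
-- s₀, and the loop invariant for while as the set of states reachable from
-- U by finitely many guarded body executions.  Each rule's syntactic
-- postcondition is then weakened to Sp by showing that every trace it
-- describes is really an execution (if-entails-sp, while-entails-sp).
-- The corollary follows because evaluation is deterministic up to
-- bisimilarity (exec-deterministic), and P is a setoid predicate.

open import Level using (Lift; lift; lower)
open import Data.Bool using (Bool; true; false)
open import Data.Nat using (ℕ; zero; suc; _+_; _≤_; s≤s)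
open import Data.Nat.Properties using (+-assoc; ≤-refl)
open import Data.List using (List; []) renaming (_∷_ to _∷ₗ_)
open import Data.Product using (Σ; _×_; _,_; proj₁; proj₂)
open import Data.Sum using (_⊎_; inj₁; inj₂)
open import Data.Empty using (⊥; ⊥-elim)
open import Relation.Nullary using (¬_)
open import Relation.Binary.PropositionalEquality
  using (_≡_; refl; sym; trans; subst)

open import Defs

end-or-cons : ∀ τ → IsEnd τ ⊎ IsCons τ
end-or-cons τ with fin τ 0
... | true  = inj₁ refl
... | false = inj₂ refl

end-cons-absurd : {b : Bool} → b ≡ true → b ≡ false → ⊥
end-cons-absurd refl ()

-- These
-- are the inductive approximants of bisimilarity; unlike _≈_ the relation
-- lives in Set and is built pointwise, which makes it easy to compose.
Agree : ℕ → Trace → Trace → Set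
Agree zero    τ τ' = hd τ ≡ hd τ' × fin τ 0 ≡ fin τ' 0
Agree (suc n) τ τ' =
  (hd τ ≡ hd τ' × fin τ 0 ≡ fin τ' 0) × (IsCons τ → Agree n (tl τ) (tl τ'))

infix 4 _≃_
_≃_ : Trace → Trace → Set
τ ≃ τ' = ∀ n → Agree n τ τ'

≃-hd : ∀ {τ τ'} → τ ≃ τ' → hd τ ≡ hd τ'
≃-hd eq = proj₁ (eq 0)

≃-end : ∀ {τ τ'} → τ ≃ τ' → IsEnd τ → IsEnd τ'
≃-end eq en = trans (sym (proj₂ (eq 0))) en

≃-cons : ∀ {τ τ'} → τ ≃ τ' → IsCons τ → IsCons τ'
≃-cons eq c = trans (sym (proj₂ (eq 0))) c

≃-tl : ∀ {τ τ'} → τ ≃ τ' → IsCons τ → tl τ ≃ tl τ'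
≃-tl eq c n = proj₂ (eq (suc n)) c

≃-refl : ∀ τ → τ ≃ τ
≃-refl τ zero    = refl , refl
≃-refl τ (suc n) = (refl , refl) , λ _ → ≃-refl (tl τ) n

≃-by-end : ∀ {τ τ'} → IsEnd τ → IsEnd τ' → hd τ ≡ hd τ' → τ ≃ τ'
≃-by-end en en' h zero    = h , trans en (sym en')
≃-by-end en en' h (suc n) =
  (h , trans en (sym en')) , λ c → ⊥-elim (end-cons-absurd en c)

≃-by-cons : ∀ {τ τ'} → IsCons τ → IsCons τ' → hd τ ≡ hd τ' →
  tl τ ≃ tl τ' → τ ≃ τ'
≃-by-cons c c' h eq zero    = h , trans c (sym c')
≃-by-cons c c' h eq (suc n) = (h , trans c (sym c')) , λ _ → eq n

≈⇒≃ : ∀ {τ τ'} → τ ≈ τ' → τ ≃ τ'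
≈⇒≃ (B , b , post) n = agree n b
  where
  agree : ∀ n {τ τ'} → B (τ , τ') → Agree n τ τ'
  agree zero {τ} {τ'} b with post (τ , τ') b
  ... | inj₁ (en , en' , h)    = h , trans en (sym en')
  ... | inj₂ (c , c' , h , _)  = h , trans c (sym c')
  agree (suc n) {τ} {τ'} b with post (τ , τ') b
  ... | inj₁ (en , en' , h)    =
    (h , trans en (sym en')) , λ c → ⊥-elim (end-cons-absurd en c)
  ... | inj₂ (c , c' , h , b') = (h , trans c (sym c')) , λ _ → agree n b'

-- It is needed because Exec itself is Set₁-valued, so unfolding Exec once
-- lands outside the Set-level functor ExecF of the definitions.
ExecF↑ : ∀ {a} → (EIdx → Set a) → EIdx → Set a
ExecF↑ {a} R (ex (x ≔ e) σ τ) =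
  Lift a (IsCons τ × hd τ ≡ σ × IsEnd (tl τ) × hd (tl τ) ≡ σ [ x ↦ ⟦ e ⟧ σ ])
ExecF↑ {a} R (ex skip σ τ) = Lift a (IsEnd τ × hd τ ≡ σ)
ExecF↑ R (ex (s₀ ⨾ s₁) σ τ') =
  Σ Trace λ τ → R (ex s₀ σ τ) × R (exs s₁ τ τ')
ExecF↑ R (ex (if e then sₜ else s_f) σ τ) =
  (σ ⊨ e × R (exs sₜ (σ ∷ ⟨ σ ⟩) τ))
  ⊎ (¬ (σ ⊨ e) × R (exs s_f (σ ∷ ⟨ σ ⟩) τ))
ExecF↑ R (ex (while e DO sₜ) σ τ') =
  (σ ⊨ e × Σ Trace λ τ → R (exs sₜ (σ ∷ ⟨ σ ⟩) τ) × R (exs (while e DO sₜ) τ τ'))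
  ⊎ (¬ (σ ⊨ e) × (IsCons τ' × hd τ' ≡ σ × IsEnd (tl τ') × hd (tl τ') ≡ σ))
ExecF↑ R (exs s τ τ') =
  (IsEnd τ × R (ex s (hd τ) τ'))
  ⊎ (IsCons τ × IsCons τ' × hd τ' ≡ hd τ × R (exs s (tl τ) (tl τ')))

ExecF↑-map : ∀ {a b} {X : EIdx → Set a} {Y : EIdx → Set b} →
  (∀ k → X k → Y k) → ∀ j → ExecF↑ X j → ExecF↑ Y j
ExecF↑-map f (ex (x ≔ e) σ τ) v = lift (lower v)
ExecF↑-map f (ex skip σ τ) v = lift (lower v)
ExecF↑-map f (ex (s₀ ⨾ s₁) σ τ) (τ₀ , x₀ , x₁) = τ₀ , f _ x₀ , f _ x₁
ExecF↑-map f (ex (if e then sₜ else s_f) σ τ) (inj₁ (g , x)) = inj₁ (g , f _ x)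
ExecF↑-map f (ex (if e then sₜ else s_f) σ τ) (inj₂ (g , x)) = inj₂ (g , f _ x)
ExecF↑-map f (ex (while e DO s) σ τ) (inj₁ (g , τ₀ , x₀ , x₁)) =
  inj₁ (g , τ₀ , f _ x₀ , f _ x₁)
ExecF↑-map f (ex (while e DO s) σ τ) (inj₂ w) = inj₂ w
ExecF↑-map f (exs s τ τ') (inj₁ (en , x)) = inj₁ (en , f _ x)
ExecF↑-map f (exs s τ τ') (inj₂ (c , c' , h , x)) = inj₂ (c , c' , h , f _ x)

↑⇒ExecF : ∀ {R : EIdx → Set} j → ExecF↑ R j → ExecF R j
↑⇒ExecF (ex (x ≔ e) σ τ) v = lower v
↑⇒ExecF (ex skip σ τ) v = lower v
↑⇒ExecF (ex (s₀ ⨾ s₁) σ τ) v = v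
↑⇒ExecF (ex (if e then sₜ else s_f) σ τ) v = v
↑⇒ExecF (ex (while e DO s) σ τ) v = v
↑⇒ExecF (exs s τ τ') v = v

ExecF⇒↑ : ∀ {R : EIdx → Set} j → ExecF R j → ExecF↑ R j
ExecF⇒↑ (ex (x ≔ e) σ τ) v = lift v
ExecF⇒↑ (ex skip σ τ) v = lift v
ExecF⇒↑ (ex (s₀ ⨾ s₁) σ τ) v = v
ExecF⇒↑ (ex (if e then sₜ else s_f) σ τ) v = v
ExecF⇒↑ (ex (while e DO s) σ τ) v = v
ExecF⇒↑ (exs s τ τ') v = v

ExecF-map : ∀ {X Y : EIdx → Set} → (∀ k → X k → Y k) → ∀ j → ExecF X j → ExecF Y j
ExecF-map f j v = ↑⇒ExecF j (ExecF↑-map f j (ExecF⇒↑ j v))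

Sem : EIdx → Set₁
Sem = GFP ExecF

unfold : ∀ j → Sem j → ExecF↑ Sem j
unfold j (R , r , post) = ExecF↑-map (λ k r' → R , r' , post) j (ExecF⇒↑ j (post j r))

-- Coinduction up to Sem: to show every S-index is derivable it suffices
-- that each unfolds by one rule into premises that are again in S or are
-- already derivable.  The post-fixed point used is S together with the
-- (Set-sized) post-fixed points witnessing the derivable premises.
module UpToSem (S : EIdx → Set) (step : ∀ j → S j → ExecF↑ (λ k → S k ⊎ Sem k) j) where

  Premise : EIdx → Set₁
  Premise k = S k ⊎ Sem k

  Inside : ∀ {k} → Premise k → EIdx → Set
  Inside (inj₁ _)       _ = ⊥
  Inside (inj₂ (R , _)) k = R k

  inside-step : ∀ {k} (c : Premise k) k' → Inside c k' → ExecF (Inside c) k'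
  inside-step (inj₁ _) k' ()
  inside-step (inj₂ (_ , _ , post)) = post

  Occ : List (Σ EIdx Premise) → EIdx → Set
  Occ []                 _ = ⊥
  Occ ((_ , c) ∷ₗ cs) k = Inside c k ⊎ Occ cs k

  occ-step : ∀ cs k → Occ cs k → ExecF (Occ cs) k
  occ-step []                 k ()
  occ-step ((_ , c) ∷ₗ cs) k (inj₁ i) = ExecF-map (λ _ → inj₁) k (inside-step c k i)
  occ-step ((_ , c) ∷ₗ cs) k (inj₂ o) = ExecF-map (λ _ → inj₂) k (occ-step cs k o)

  premises : ∀ j → ExecF↑ Premise j → List (Σ EIdx Premise)
  premises (ex (x ≔ e) σ τ) _ = []
  premises (ex skip σ τ) _ = []
  premises (ex (s₀ ⨾ s₁) σ τ) (_ , c₀ , c₁) = (_ , c₀) ∷ₗ (_ , c₁) ∷ₗ []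
  premises (ex (if e then sₜ else s_f) σ τ) (inj₁ (_ , c)) = (_ , c) ∷ₗ []
  premises (ex (if e then sₜ else s_f) σ τ) (inj₂ (_ , c)) = (_ , c) ∷ₗ []
  premises (ex (while e DO s) σ τ) (inj₁ (_ , _ , c₀ , c₁)) = (_ , c₀) ∷ₗ (_ , c₁) ∷ₗ []
  premises (ex (while e DO s) σ τ) (inj₂ _) = []
  premises (exs s τ τ') (inj₁ (_ , c)) = (_ , c) ∷ₗ []
  premises (exs s τ τ') (inj₂ (_ , _ , _ , c)) = (_ , c) ∷ₗ []

  route : ∀ {A : Set} {k} (c : Premise k) → (S k → A) → (Inside c k → A) → A
  route (inj₁ s)           f g = f s
  route (inj₂ (_ , r , _)) f g = g r

  redistribute : ∀ {Z : EIdx → Set} j (v : ExecF↑ Premise j) →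
    (∀ {k} → S k → Z k) → (∀ {k} → Occ (premises j v) k → Z k) → ExecF Z j
  redistribute (ex (x ≔ e) σ τ) v f g = lower v
  redistribute (ex skip σ τ) v f g = lower v
  redistribute (ex (s₀ ⨾ s₁) σ τ) (τ₀ , c₀ , c₁) f g =
    τ₀ , route c₀ f (λ i → g (inj₁ i)) , route c₁ f (λ i → g (inj₂ (inj₁ i)))
  redistribute (ex (if e then sₜ else s_f) σ τ) (inj₁ (h , c)) f g =
    inj₁ (h , route c f (λ i → g (inj₁ i)))
  redistribute (ex (if e then sₜ else s_f) σ τ) (inj₂ (h , c)) f g =
    inj₂ (h , route c f (λ i → g (inj₁ i)))
  redistribute (ex (while e DO s) σ τ) (inj₁ (h , τ₀ , c₀ , c₁)) f g =
    inj₁ (h , τ₀ , route c₀ f (λ i → g (inj₁ i)) , route c₁ f (λ i → g (inj₂ (inj₁ i))))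
  redistribute (ex (while e DO s) σ τ) (inj₂ w) f g = inj₂ w
  redistribute (exs s τ τ') (inj₁ (en , c)) f g =
    inj₁ (en , route c f (λ i → g (inj₁ i)))
  redistribute (exs s τ τ') (inj₂ (c₁ , c₂ , h , c)) f g =
    inj₂ (c₁ , c₂ , h , route c f (λ i → g (inj₁ i)))

  T : EIdx → Set
  T k = S k ⊎ Σ EIdx λ j → Σ (S j) λ p → Occ (premises j (step j p)) k

  T-post : ∀ k → T k → ExecF T k
  T-post k (inj₁ p) = redistribute k (step k p) inj₁ (λ o → inj₂ (k , p , o))
  T-post k (inj₂ (j , p , o)) =
    ExecF-map (λ _ o' → inj₂ (j , p , o')) k (occ-step (premises j (step j p)) k o)

  up-to : ∀ j → S j → Sem j
  up-to j p = T , inj₁ p , T-post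

fold : ∀ j → ExecF↑ Sem j → Sem j
fold j v = UpToSem.up-to (_≡ j) step j refl
  where
  step : ∀ k → k ≡ j → ExecF↑ (λ k → (k ≡ j) ⊎ Sem k) k
  step k refl = ExecF↑-map (λ _ → inj₂) j v

-- s, σ::⟨σ⟩ ⇒* τ' is obtained from s, σ ⇒ tl τ' when τ' starts with σ; this
-- is the shape of the premises of the if and while rules.
execs-dup : ∀ {s σ τ'} → IsCons τ' → hd τ' ≡ σ → Exec s σ (tl τ') →
  Execs s (σ ∷ ⟨ σ ⟩) τ'
execs-dup {s} {σ} {τ'} c h x =
  fold (exs s (σ ∷ ⟨ σ ⟩) τ')
    (inj₂ (refl , c , h , fold (exs s ⟨ σ ⟩ (tl τ')) (inj₁ (refl , x))))

execs-dup-cons : ∀ s {σ τ} → Execs s (σ ∷ ⟨ σ ⟩) τ → IsCons τ × hd τ ≡ σ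
execs-dup-cons s {σ} {τ} x with unfold (exs s (σ ∷ ⟨ σ ⟩) τ) x
... | inj₁ (() , _)
... | inj₂ (_ , c , h , _) = c , h

exec-hd  : ∀ s {σ τ} → Exec s σ τ → hd τ ≡ σ
execs-hd : ∀ s {τ τ'} → Execs s τ τ' → hd τ' ≡ hd τ
exec-hd (x ≔ e) {σ} {τ} X = proj₁ (proj₂ (lower (unfold (ex (x ≔ e) σ τ) X)))
exec-hd skip {σ} {τ} X = proj₂ (lower (unfold (ex skip σ τ) X))
exec-hd (s₀ ⨾ s₁) {σ} {τ} X with unfold (ex (s₀ ⨾ s₁) σ τ) X
... | (_ , X₀ , X₁) = trans (execs-hd s₁ X₁) (exec-hd s₀ X₀)
exec-hd (if e then sₜ else s_f) {σ} {τ} X with unfold (ex (if e then sₜ else s_f) σ τ) X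
... | inj₁ (_ , Y) = proj₂ (execs-dup-cons sₜ Y)
... | inj₂ (_ , Y) = proj₂ (execs-dup-cons s_f Y)
exec-hd (while e DO s) {σ} {τ'} X with unfold (ex (while e DO s) σ τ') X
... | inj₂ (_ , _ , h , _ , _) = h
... | inj₁ (_ , τ , Y₁ , Y₂) with execs-dup-cons s Y₁ | unfold (exs (while e DO s) τ τ') Y₂
...   | (c , h) | inj₁ (en , _)         = ⊥-elim (end-cons-absurd en c)
...   | (c , h) | inj₂ (_ , _ , h' , _) = trans h' h
execs-hd s {τ} {τ'} X with unfold (exs s τ τ') X
... | inj₁ (_ , Y)         = exec-hd s Y
... | inj₂ (_ , _ , h , _) = h

exec-resp : ∀ {s σ τ τ'} → Exec s σ τ → τ ≃ τ' → Exec s σ τ'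
exec-resp {s} {σ} {τ} {τ'} (R , r , post) eq = R' , (τ , r , eq) , post'
  where
  R' : EIdx → Set
  R' (ex s σ b')  = Σ Trace λ b → R (ex s σ b) × b ≃ b'
  R' (exs s t b') = Σ Trace λ b → R (exs s t b) × b ≃ b'
  pair : ∀ {b b' σ σ'} → b ≃ b' →
    IsCons b × hd b ≡ σ × IsEnd (tl b) × hd (tl b) ≡ σ' →
    IsCons b' × hd b' ≡ σ × IsEnd (tl b') × hd (tl b') ≡ σ'
  pair eq (c , h , en , h') =
    ≃-cons eq c , trans (sym (≃-hd eq)) h ,
    ≃-end (≃-tl eq c) en , trans (sym (≃-hd (≃-tl eq c))) h'
  post' : ∀ j → R' j → ExecF R' j
  post' (ex (x ≔ e) σ b') (b , r , eq) = pair eq (post (ex (x ≔ e) σ b) r)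
  post' (ex skip σ b') (b , r , eq) with post (ex skip σ b) r
  ... | (en , h) = ≃-end eq en , trans (sym (≃-hd eq)) h
  post' (ex (s₀ ⨾ s₁) σ b') (b , r , eq) with post (ex (s₀ ⨾ s₁) σ b) r
  ... | (τ , r₀ , r₁) = τ , (τ , r₀ , ≃-refl τ) , (b , r₁ , eq)
  post' (ex (if e then sₜ else s_f) σ b') (b , r , eq) with post (ex (if e then sₜ else s_f) σ b) r
  ... | inj₁ (g , r₁) = inj₁ (g , (b , r₁ , eq))
  ... | inj₂ (g , r₁) = inj₂ (g , (b , r₁ , eq))
  post' (ex (while e DO sₜ) σ b') (b , r , eq) with post (ex (while e DO sₜ) σ b) r
  ... | inj₁ (g , τ , r₁ , r₂) = inj₁ (g , τ , (τ , r₁ , ≃-refl τ) , (b , r₂ , eq))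
  ... | inj₂ (g , w) = inj₂ (g , pair eq w)
  post' (exs s t b') (b , r , eq) with post (exs s t b) r
  ... | inj₁ (en , r')          = inj₁ (en , (b , r' , eq))
  ... | inj₂ (c , c' , h , r')  =
    inj₂ (c , ≃-cons eq c' , trans (sym (≃-hd eq)) h , (tl b , r' , ≃-tl eq c'))

-- Two runs of the same statement stack from observationally
-- equal traces produce bisimilar traces.  A stack κ = s₁ ∷ s₂ ∷ … records
-- the pending extended executions (sequential compositions and loop
-- iterations still to run).  Evaluating skip or a sequence emits no step,
-- so reaching the next step is a recursion on the size of the stack.
infixr 5 _∷ₖ_
data Stack : Set where
  []ₖ  : Stack
  _∷ₖ_ : Stmt → Stack → Stack

size : Stmt → ℕ
size (s₀ ⨾ s₁) = suc (size s₀ + size s₁)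
size _         = 1

stack-size : Stack → ℕ
stack-size []ₖ      = 0
stack-size (s ∷ₖ κ) = size s + stack-size κ

module Determinism (R₁ : EIdx → Set) (post₁ : ∀ j → R₁ j → ExecF R₁ j)
                   (R₂ : EIdx → Set) (post₂ : ∀ j → R₂ j → ExecF R₂ j) where

  RunStack : (R : EIdx → Set) → Stack → Trace → Trace → Set
  RunStack R []ₖ      τ τ' = τ ≃ τ'
  RunStack R (s ∷ₖ κ) τ τ' = Σ Trace λ μ → R (exs s τ μ) × RunStack R κ μ τ'

  run-cons : ∀ {R} (post : ∀ j → R j → ExecF R j) κ {τ τ'} → IsCons τ →
    RunStack R κ τ τ' → IsCons τ' × hd τ' ≡ hd τ × RunStack R κ (tl τ) (tl τ')
  run-cons post []ₖ c eq = ≃-cons eq c , sym (≃-hd eq) , ≃-tl eq c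
  run-cons post (s ∷ₖ κ) {τ} c (μ , r , run) with post (exs s τ μ) r
  ... | inj₁ (en , _) = ⊥-elim (end-cons-absurd en c)
  ... | inj₂ (_ , cμ , hμ , r') with run-cons post κ cμ run
  ...   | (c' , h' , run') = c' , trans h' hμ , (tl μ , r' , run')

  D : Trace × Trace → Set
  D (a , b) =
    (Σ Stack λ κ → Σ Trace λ τ → Σ Trace λ τ' →
       τ ≃ τ' × RunStack R₁ κ τ a × RunStack R₂ κ τ' b)
    ⊎ (Σ Stmt λ s → Σ State λ σ → R₁ (ex s σ a) × R₂ (ex s σ b))

  emit : ∀ κ {τ τ' a b} → τ ≃ τ' → IsCons τ →
    RunStack R₁ κ τ a → RunStack R₂ κ τ' b → BisimF D (a , b)
  emit κ eq c run₁ run₂ with run-cons post₁ κ c run₁ | run-cons post₂ κ (≃-cons eq c) run₂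
  ... | (ca , ha , run₁') | (cb , hb , run₂') =
    inj₂ (ca , cb , trans ha (trans (≃-hd eq) (sym hb)) ,
          inj₁ (κ , _ , _ , ≃-tl eq c , run₁' , run₂'))

  run-step  : ∀ n κ → stack-size κ ≤ n → ∀ {τ τ' a b} → τ ≃ τ' →
    RunStack R₁ κ τ a → RunStack R₂ κ τ' b → BisimF D (a , b)
  exec-step : ∀ n s κ → size s + stack-size κ ≤ n → ∀ {σ x y a b} →
    R₁ (ex s σ x) → R₂ (ex s σ y) → RunStack R₁ κ x a → RunStack R₂ κ y b →
    BisimF D (a , b)

  run-step n []ₖ _ {τ} eq run₁ run₂ with end-or-cons τ
  ... | inj₂ c  = emit []ₖ eq c run₁ run₂
  ... | inj₁ en = inj₁ (≃-end run₁ en , ≃-end run₂ (≃-end eq en) ,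
                        trans (sym (≃-hd run₁)) (trans (≃-hd eq) (≃-hd run₂)))
  run-step n (s ∷ₖ κ) le {τ} {τ'} eq (x , r₁ , run₁) (y , r₂ , run₂) with end-or-cons τ
  ... | inj₂ c  = emit (s ∷ₖ κ) eq c (x , r₁ , run₁) (y , r₂ , run₂)
  ... | inj₁ en with post₁ (exs s τ x) r₁ | post₂ (exs s τ' y) r₂
  ...   | inj₂ (c , _) | _            = ⊥-elim (end-cons-absurd en c)
  ...   | inj₁ _       | inj₂ (c , _) = ⊥-elim (end-cons-absurd (≃-end eq en) c)
  ...   | inj₁ (_ , r₁') | inj₁ (_ , r₂') =
    exec-step n s κ le r₁' (subst (λ σ → R₂ (ex s σ y)) (sym (≃-hd eq)) r₂') run₁ run₂

  pair-≃ : ∀ {x y σ σ'} →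
    IsCons x × hd x ≡ σ × IsEnd (tl x) × hd (tl x) ≡ σ' →
    IsCons y × hd y ≡ σ × IsEnd (tl y) × hd (tl y) ≡ σ' → x ≃ y
  pair-≃ (c , h , en , h') (c' , k , en' , k') =
    ≃-by-cons c c' (trans h (sym k)) (≃-by-end en en' (trans h' (sym k')))

  exec-step n (v ≔ e) κ _ {σ} {x} {y} r₁ r₂ run₁ run₂ with post₁ (ex (v ≔ e) σ x) r₁
  ... | w@(c , _) = emit κ (pair-≃ w (post₂ (ex (v ≔ e) σ y) r₂)) c run₁ run₂
  exec-step (suc n) skip κ (s≤s le) {σ} {x} {y} r₁ r₂ run₁ run₂
    with post₁ (ex skip σ x) r₁ | post₂ (ex skip σ y) r₂
  ... | (en , h) | (en' , h') = run-step n κ le (≃-by-end en en' (trans h (sym h'))) run₁ run₂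
  exec-step (suc n) (s₀ ⨾ s₁) κ (s≤s le) {σ} {x} {y} r₁ r₂ run₁ run₂
    with post₁ (ex (s₀ ⨾ s₁) σ x) r₁ | post₂ (ex (s₀ ⨾ s₁) σ y) r₂
  ... | (_ , r₁₀ , r₁₁) | (_ , r₂₀ , r₂₁) =
    exec-step n s₀ (s₁ ∷ₖ κ) (subst (_≤ n) (+-assoc (size s₀) (size s₁) (stack-size κ)) le)
      r₁₀ r₂₀ (_ , r₁₁ , run₁) (_ , r₂₁ , run₂)
  exec-step n (if e then sₜ else s_f) κ _ {σ} {x} {y} r₁ r₂ run₁ run₂
    with post₁ (ex (if e then sₜ else s_f) σ x) r₁ | post₂ (ex (if e then sₜ else s_f) σ y) r₂
  ... | inj₁ (_ , r₁') | inj₁ (_ , r₂') =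
    emit (sₜ ∷ₖ κ) (≃-refl (σ ∷ ⟨ σ ⟩)) refl (_ , r₁' , run₁) (_ , r₂' , run₂)
  ... | inj₂ (_ , r₁') | inj₂ (_ , r₂') =
    emit (s_f ∷ₖ κ) (≃-refl (σ ∷ ⟨ σ ⟩)) refl (_ , r₁' , run₁) (_ , r₂' , run₂)
  ... | inj₁ (g , _) | inj₂ (¬g , _) = ⊥-elim (¬g g)
  ... | inj₂ (¬g , _) | inj₁ (g , _) = ⊥-elim (¬g g)
  exec-step n (while e DO s) κ _ {σ} {x} {y} r₁ r₂ run₁ run₂
    with post₁ (ex (while e DO s) σ x) r₁ | post₂ (ex (while e DO s) σ y) r₂
  ... | inj₁ (_ , μ₁ , ra₁ , rb₁) | inj₁ (_ , μ₂ , ra₂ , rb₂) =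
    emit (s ∷ₖ (while e DO s) ∷ₖ κ) (≃-refl (σ ∷ ⟨ σ ⟩)) refl
      (μ₁ , ra₁ , (_ , rb₁ , run₁)) (μ₂ , ra₂ , (_ , rb₂ , run₂))
  ... | inj₂ (_ , w₁@(c , _)) | inj₂ (_ , w₂) = emit κ (pair-≃ w₁ w₂) c run₁ run₂
  ... | inj₁ (g , _) | inj₂ (¬g , _) = ⊥-elim (¬g g)
  ... | inj₂ (¬g , _) | inj₁ (g , _) = ⊥-elim (¬g g)

exec-deterministic : ∀ {s σ a b} → Exec s σ a → Exec s σ b → a ≈ b
exec-deterministic {s} {σ} {a} {b} (R₁ , r₁ , post₁) (R₂ , r₂ , post₂) =
  D , inj₂ (s , σ , r₁ , r₂) , D-post
  where
  open Determinism R₁ post₁ R₂ post₂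
  D-post : ∀ j → D j → BisimF D j
  D-post (a , b) (inj₁ (κ , _ , _ , eq , run₁ , run₂)) =
    run-step (stack-size κ) κ ≤-refl eq run₁ run₂
  D-post (a , b) (inj₂ (s , σ , r₁ , r₂)) =
    exec-step (size s + 0) s []ₖ ≤-refl r₁ r₂ (≃-refl a) (≃-refl b)

data EndsAt : Trace → State → Set where
  at-end  : ∀ {τ} → IsEnd τ → EndsAt τ (hd τ)
  at-cons : ∀ {τ σ} → IsCons τ → EndsAt (tl τ) σ → EndsAt τ σ

follows-unfold : ∀ {q} {Q : Trace → Set q} {τ τ'} → Follows Q τ τ' →
  (IsEnd τ × hd τ' ≡ hd τ × Q τ')
  ⊎ (IsCons τ × IsCons τ' × hd τ' ≡ hd τ × Follows Q (tl τ) (tl τ'))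
follows-unfold {τ = τ} {τ'} (R , r , post) with post (τ , τ') r
... | inj₁ w                  = inj₁ w
... | inj₂ (c , c' , h , r') = inj₂ (c , c' , h , (R , r' , post))

follows-hd : ∀ {q} {Q : Trace → Set q} {R : Trace × Trace → Set} →
  (∀ j → R j → FollowsF Q R j) → ∀ {τ τ'} → R (τ , τ') → hd τ' ≡ hd τ
follows-hd post {τ} {τ'} r with post (τ , τ') r
... | inj₁ (_ , h , _)     = h
... | inj₂ (_ , _ , h , _) = h

-- A trace all of whose final states satisfy W satisfies A ** ⟨W⟩ whenever
-- it satisfies A: it follows itself into ⟨W⟩.  This is how the
-- intermediate assertions of ⨾ and while are introduced.
chop-final-states : (A : TPred) (W : StPred) →
  (∀ τ → pred A τ → ∀ σ → EndsAt τ σ → W σ) → A ⊨ᵗ (A ** ⟨ W ⟩ᵗ)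
chop-final-states A W final τ a = τ , a , (R , (refl , λ _ e → e) , post)
  where
  R : Trace × Trace → Set
  R (μ , μ') = μ ≡ μ' × (∀ σ → EndsAt μ σ → EndsAt τ σ)
  post : ∀ j → R j → FollowsF (pred ⟨ W ⟩ᵗ) R j
  post (μ , .μ) (refl , suffix) with end-or-cons μ
  ... | inj₁ en = inj₁ (en , refl , en , final τ a (hd μ) (suffix _ (at-end en)))
  ... | inj₂ c  = inj₂ (c , c , refl , refl , λ σ e → suffix σ (at-cons c e))

dup-chop : ∀ {U : StPred} {Q : TPred} {τ'} → pred (dup U ** Q) τ' →
  Σ State λ σ → U σ × IsCons τ' × hd τ' ≡ σ × hd (tl τ') ≡ σ × pred Q (tl τ')
dup-chop (t , (c , en , h , u) , fw) with follows-unfold fw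
... | inj₁ (en' , _) = ⊥-elim (end-cons-absurd en' c)
... | inj₂ (_ , c' , h₁ , fw') with follows-unfold fw'
...   | inj₂ (c'' , _)   = ⊥-elim (end-cons-absurd en c'')
...   | inj₁ (_ , h₂ , q) = hd t , u , c' , h₁ , trans h₂ h , q

Sp : StPred → Stmt → TPred
pred (Sp U s) τ = Σ State λ σ → U σ × Exec s σ τ
resp (Sp U s) eq (σ , u , x) = σ , u , exec-resp x (≈⇒≃ eq)

_∨ᵗ_ : TPred → TPred → TPred
pred (A ∨ᵗ B) τ = pred A τ ⊎ pred B τ
resp (A ∨ᵗ B) eq (inj₁ a) = inj₁ (resp A eq a)
resp (A ∨ᵗ B) eq (inj₂ b) = inj₂ (resp B eq b)

weaken : ∀ {U s P P'} → ⊢[ U ] s [ P' ] → P' ⊨ᵗ P → ⊢[ U ] s [ P ]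
weaken = h-conseq (λ _ u → u)

follows-sp⇒execs : ∀ s {V : StPred} {τ τ'} → Follows (pred (Sp V s)) τ τ' → Execs s τ τ'
follows-sp⇒execs s {V} {τ} {τ'} (F , f , post) = UpToSem.up-to S step (exs s τ τ') (refl , f)
  where
  S : EIdx → Set
  S (ex _ _ _)   = ⊥
  S (exs s' a b) = s' ≡ s × F (a , b)
  step : ∀ j → S j → ExecF↑ (λ k → S k ⊎ Sem k) j
  step (exs s' a b) (refl , r) with post (a , b) r
  ... | inj₁ (en , h , (σ , _ , x)) with trans (sym (exec-hd s x)) h
  ...   | refl = inj₁ (en , inj₂ x)
  step (exs s' a b) (refl , r)
      | inj₂ (c , c' , h , r') = inj₂ (c , c' , h , inj₁ (refl , r'))

if-entails-sp : ∀ (U : StPred) e sₜ s_f →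
  (dup U ** (Sp (e ∧ᵉ U) sₜ ∨ᵗ Sp (e ¬∧ᵉ U) s_f)) ⊨ᵗ Sp U (if e then sₜ else s_f)
if-entails-sp U e sₜ s_f τ' p with dup-chop {U} {Sp (e ∧ᵉ U) sₜ ∨ᵗ Sp (e ¬∧ᵉ U) s_f} p
... | σ , u , c , h , h' , inj₁ (σ₁ , (g , _) , x) with trans (sym (exec-hd sₜ x)) h'
...   | refl = σ , u , fold _ (inj₁ (g , execs-dup c h x))
if-entails-sp U e sₜ s_f τ' p
    | σ , u , c , h , h' , inj₂ (σ₁ , (¬g , _) , x) with trans (sym (exec-hd s_f x)) h'
...   | refl = σ , u , fold _ (inj₂ (¬g , execs-dup c h x))

module WhileExecution (e : Expr) (body : Stmt) (I : StPred) (P : TPred)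
  (P-runs-body : ∀ τ → pred P τ → Σ State λ σ → σ ⊨ e × Exec body σ τ)
  (RD : Trace → Set) (RD-post : ∀ τ → RD τ → DaggerF (pred (P ** dup I)) RD τ)
  (F : Trace × Trace → Set) (F-post : ∀ j → F j → FollowsF (pred ⟨ ¬ᵉ e ⟩ᵗ) F j)
  where

  W : Stmt
  W = while e DO body

  Unfolded : Trace → Set₁
  Unfolded = DaggerF (pred (P ** dup I)) RD

  -- Within u (a , b): u splits the iteration trace into a body run t₁
  -- followed by the rest; a is a suffix of t₁ and b the corresponding
  -- suffix of the loop trace.
  Within : ∀ {td} → Unfolded td → Trace × Trace → Set
  Within (inj₁ _) _ = ⊥
  Within (inj₂ (_ , (_ , _ , (F₁ , _)) , (F₂ , _))) (a , b) =
    Σ Trace λ a₀ → Σ Trace λ aᵈ → F₁ (a , a₀) × F₂ (a₀ , aᵈ) × F (aᵈ , b)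

  InBody : Trace × Trace → Set
  InBody (a , b) = Σ Trace λ td → Σ (RD td) λ r → Within (RD-post td r) (a , b)

  Loop : State → Trace → Set
  Loop σ b = Σ Trace λ td → RD td × F (td , tl b) × IsCons b × hd b ≡ σ × hd (tl b) ≡ σ

  -- the judgements to be shown: the loop runs from σ to a Loop trace, and
  -- the loop continues from inside a body run (possibly just after the
  -- duplicated guard state)
  S : EIdx → Set
  S (ex s σ b)  = s ≡ W × Loop σ b
  S (exs s a b) = s ≡ W ×
    (InBody (a , b) ⊎ (IsCons a × IsCons b × hd b ≡ hd a × InBody (tl a , tl b)))

  Premise : EIdx → Set₁
  Premise k = S k ⊎ Sem k

  enter : ∀ {td} (r : RD td) {u} → RD-post td r ≡ u → ∀ {a b} →
    Within u (a , b) → InBody (a , b)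
  enter {td} r eq w = td , r , subst (λ u → Within u _) (sym eq) w

  loop-step : ∀ σ b → Loop σ b → ExecF↑ Premise (ex W σ b)
  loop-step σ b (td , r , f , cb , hb , htb) with RD-post td r in eq
  ... | inj₁ en with F-post (td , tl b) f
  ...   | inj₁ (_ , _ , enb , lift ¬g) =
    inj₂ (subst (λ σ' → ¬ (σ' ⊨ e)) htb ¬g , cb , hb , enb , htb)
  ...   | inj₂ (c , _) = ⊥-elim (end-cons-absurd en c)
  loop-step σ b (td , r , f , cb , hb , htb)
      | inj₂ (t₀ , (t₁ , p , (F₁ , f₁ , post₁)) , (F₂ , f₂ , post₂))
      with P-runs-body t₁ p
  ... | (σ₁ , g , x)
      -- the body run starts at σ: follow the heads back through F, F₂, F₁
      with trans (sym (exec-hd body x))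
             (trans (sym (follows-hd post₁ f₁))
               (trans (sym (follows-hd post₂ f₂))
                 (trans (sym (follows-hd F-post f)) htb)))
  ...   | refl =
    inj₁ (g , σ ∷ t₁ , inj₂ (execs-dup refl refl x) ,
          inj₁ (refl , inj₂ (refl , cb , hb , enter r eq (t₀ , td , f₁ , f₂ , f))))

  -- Inside a body run the loop trace copies the body's steps; at the end of
  -- the body run the next iteration trace begins.
  body-step : ∀ a b → InBody (a , b) → ExecF↑ Premise (exs W a b)
  body-step a b (td , r , w) with RD-post td r in eq
  body-step a b (td , r , ()) | inj₁ _
  body-step a b (td , r , (a₀ , aᵈ , g₁ , g₂ , g₃))
      | inj₂ (t₀ , (t₁ , p , (F₁ , f₁ , post₁)) , (F₂ , f₂ , post₂))
      with post₁ (a , a₀) g₁ | post₂ (a₀ , aᵈ) g₂ | F-post (aᵈ , b) g₃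
  ... | inj₂ (_ , c₀ , _) | inj₁ (en , _) | _ = ⊥-elim (end-cons-absurd en c₀)
  ... | inj₁ (_ , _ , c₀ , _) | inj₁ (en , _) | _ = ⊥-elim (end-cons-absurd en c₀)
  ... | _ | inj₂ (_ , cᵈ , _) | inj₁ (en , _) = ⊥-elim (end-cons-absurd en cᵈ)
  ... | inj₂ (ca , _ , h₁ , g₁') | inj₂ (_ , _ , h₂ , g₂') | inj₂ (_ , cb , h₃ , g₃') =
    inj₂ (ca , cb , trans h₃ (trans h₂ h₁) ,
          inj₁ (refl , inj₁ (enter r eq (tl a₀ , tl aᵈ , g₁' , g₂' , g₃'))))
  ... | inj₁ (ea , h₁ , (_ , en₀ , h₁' , _))
      | inj₂ (_ , _ , h₂ , g₂') | inj₂ (_ , cb , h₃ , g₃')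
      with post₂ (tl a₀ , tl aᵈ) g₂'
  ...   | inj₂ (c , _)       = ⊥-elim (end-cons-absurd en₀ c)
  ...   | inj₁ (_ , h₂' , r') =
    inj₁ (ea , inj₁ (refl , tl aᵈ , r' , g₃' , cb , trans h₃ (trans h₂ h₁) ,
      trans (follows-hd F-post g₃') (trans h₂' (trans h₁' h₁))))

  step : ∀ j → S j → ExecF↑ Premise j
  step (ex s σ b)  (refl , l)      = loop-step σ b l
  step (exs s a b) (refl , inj₁ i) = body-step a b i
  step (exs s a b) (refl , inj₂ (ca , cb , h , i)) =
    inj₂ (ca , cb , h , inj₁ (refl , inj₁ i))

  loop-executes : ∀ σ b → Loop σ b → Exec W σ b
  loop-executes σ b l = UpToSem.up-to S step (ex W σ b) (refl , l)

while-entails-sp : ∀ (U : StPred) e body (I : StPred) (P : TPred) →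
  (∀ τ → pred P τ → Σ State λ σ → σ ⊨ e × Exec body σ τ) →
  (dup U ** ((P ** dup I) †) ** ⟨ ¬ᵉ e ⟩ᵗ) ⊨ᵗ Sp U (while e DO body)
while-entails-sp U e body I P P-runs-body τ' p
  with dup-chop {U} {((P ** dup I) †) ** ⟨ ¬ᵉ e ⟩ᵗ} p
... | σ , u , c , h , h' , (td , (RD , rd , RD-post) , (F , f , F-post)) =
  σ , u , loop-executes σ τ' (td , rd , f , c , h , h')
  where open WhileExecution e body I P P-runs-body RD RD-post F F-post

data Reachable (U : StPred) (e : Expr) (body : Stmt) : State → Set₁ where
  start : ∀ {σ} → U σ → Reachable U e body σ
  again : ∀ {σ τ σ'} → Reachable U e body σ → σ ⊨ e → Exec body σ τ →
    EndsAt τ σ' → Reachable U e body σ'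

complete : ∀ s U → ⊢[ U ] s [ Sp U s ]
complete (x ≔ e) U =
  weaken h-assign λ τ (c , en , h , u) → hd τ , u , fold _ (lift (c , refl , en , h))
complete skip U =
  weaken h-skip λ τ (en , u) → hd τ , u , fold _ (lift (en , refl))
complete (s₀ ⨾ s₁) U =
  weaken (h-seq {P = Sp U s₀}
            (weaken (complete s₀ U) (chop-final-states (Sp U s₀) V final))
            (complete s₁ V))
    λ τ' (τ , (σ , u , x) , fw) → σ , u , fold _ (τ , x , follows-sp⇒execs s₁ fw)
  where
  V : StPred
  V σ' = Σ State λ σ → U σ × Σ Trace λ τ → Exec s₀ σ τ × EndsAt τ σ'
  final : ∀ τ → pred (Sp U s₀) τ → ∀ σ' → EndsAt τ σ' → V σ'
  final τ (σ , u , x) σ' e = σ , u , τ , x , e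
complete (if e then sₜ else s_f) U =
  weaken (h-if {P = Branches} (weaken (complete sₜ (e ∧ᵉ U)) (λ _ → inj₁))
                             (weaken (complete s_f (e ¬∧ᵉ U)) (λ _ → inj₂)))
    (if-entails-sp U e sₜ s_f)
  where
  Branches : TPred
  Branches = Sp (e ∧ᵉ U) sₜ ∨ᵗ Sp (e ¬∧ᵉ U) s_f
complete (while e DO body) U =
  weaken (h-while {I = I} {P = P} (λ _ → start)
            (weaken (complete body (e ∧ᵉ I)) (chop-final-states P I final)))
    (while-entails-sp U e body I P λ τ (σ , (g , _) , x) → σ , g , x)
  where
  I : StPred
  I = Reachable U e body
  P : TPred
  P = Sp (e ∧ᵉ I) body
  final : ∀ τ → pred P τ → ∀ σ' → EndsAt τ σ' → I σ'
  final τ (σ , (g , r) , x) σ' en = again r g x en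

-- Completeness for total correctness: if every state in U has an execution
-- satisfying P, then by determinism every execution from U satisfies P, so
-- the strongest postcondition entails P.
corollary3p18 : (s : Stmt) (U : StPred) (P : TPred) →
    (∀ σ → U σ → Σ Trace (λ τ → Exec s σ τ × pred P τ)) →
    ⊢[ U ] s [ P ]
corollary3p18 s U P terminates = weaken (complete s U) sp-entails-P
  where
  sp-entails-P : Sp U s ⊨ᵗ P
  sp-entails-P τ (σ , u , x) with terminates σ u
  ... | (τ' , x' , p) = resp P (exec-deterministic x' x) p
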